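{- Let $K$ be a knowledge base in $\mathcal{ALC}^\Omega$ and let $K^T$ be its translation in $\mathcal{ALCOI}$. If $K^T$ has a model in $\mathcal{ALCOI}$, then it has a finite model.
   Context: **$\mathcal{ALC}^\Omega$ syntax.** Let $N_C,N_R,N_I$ be disjoint sets of concept, role and individual names. Concepts: $A\in N_C$, $\top$, $\bot$, and, for concepts $C,D$ and $R\in N_R$: $C\sqcap D$, $C\sqcup D$, $\neg C$, $C\backslash D$, $\mathtt{Pow}(C)$, $\forall R.C$, $\exists R.C$. A knowledge base (KB) is $K=(\mathcal T,\mathcal A)$, with $\mathcal T$ (TBox) a (finite) set of inclusions $C\sqsubseteq D$, and $\mathcal A$ (ABox) a (finite) set of assertions $C(a)$, $R(a,b)$ ($a,b\in N_I$), concept membership axioms $C\in D$ and role membership axioms $(C,D)\in R$. **$\mathcal{ALCOI}$.** The standard description logic $\mathcal{ALC}$ extended with inverse roles $R^-$ (where $(x,y)\in(R^-)^I$ iff $(y,x)\in R^I$) and nominals $\{a\}$ (where $(\{a\})^I=\{a^I\}$). An interpretation $I=\langle\Delta,\cdot^I\rangle$ has a non-empty domain $\Delta$, $A^I\subseteq\Delta$, $R^I\subseteq\Delta\times\Delta$, $a^I\in\Delta$, with the usual semantics of $\top,\bot,\neg,\sqcap,\sqcup,\forall R.C,\exists R.C$. It satisfies $C\sqsubseteq D$ iff $C^I\subseteq D^I$; $C(a)$ iff $a^I\in C^I$; $R(a,b)$ iff $(a^I,b^I)\in R^I$; $C\equiv D$ abbreviates $C\sqsubseteq D$ and $D\sqsubseteq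 C$. It is a model of a KB if it satisfies all its axioms; it is finite if $\Delta$ is finite. **Translation.** Let $e$ be a new role name. For an $\mathcal{ALC}^\Omega$ concept $C$, $C^T$ is obtained by recursively replacing each subconcept $\mathtt{Pow}(D)$ by $\forall e.D^T$; $T$ commutes with all other constructors (with $C\backslash D$ read as $C\sqcap\neg D$), and $B^T=B$ for concept names $B$. For each concept $C$ occurring as an instance in a membership axiom of $K$ (i.e. $C$ in $C\in D$; $C$ and $D$ in $(C,D)\in R$) introduce a new individual name $e_C$. Then $K^T=(\mathcal T^T,\mathcal A^T)$, where $\mathcal T^T$ consists of $C^T\sqsubseteq D^T$ for each $C\sqsubseteq D\in\mathcal T$, and $C^T\equiv\exists e^-.\{e_C\}$ for each such new name $e_C$; and $\mathcal A^T$ consists of: $D^T(e_C)$ for each $C\in D$ in $\mathcal A$; $R(e_C,e_D)$ for each $(C,D)\in R$ in $\mathcal A$; $D^T(a)$ for each $D(a)$ in $\mathcal A$; $R(a,b)$ for each $R(a,b)$ in $\mathcal A$; and $(\neg\exists e.\top)(a)$ for each (original) individual name $a\in N_I$. -}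

module Defs where

open import Data.Fin.Base using (Fin)
open import Data.List.Base using (List)
open import Data.List.Membership.Propositional using () renaming (_∈_ to _∈ˡ_)
open import Data.Nat.Base using (ℕ)
open import Data.Product.Base using (_×_; ∃; ∃-syntax)
open import Function.Base using (flip)
open import Function.Bundles using (_↔_)
open import Level using (0ℓ)
open import Relation.Binary.Core using (Rel)
open import Relation.Unary using (Pred; _∈_; _⊆_; _∩_; _∪_; ∁; U; ∅; ｛_｝)

-- Concept, role and individual names are separate types, so the three
-- name sets are automatically disjoint.

module ALCΩ (N-C N-R N-I : Set) where

  infixr 7 _⊓_
  infixr 6 _⊔_
  infix  4 _⊑_
  infix  8 ~_ _∖_

  data Concept : Set where
    name    : N-C → Concept
    ⊤ᶜ ⊥ᶜ   : Concept
    _⊓_ _⊔_ : Concept → Concept → Concept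
    ~_      : Concept → Concept
    _∖_     : Concept → Concept → Concept
    Pow     : Concept → Concept
    all some : N-R → Concept → Concept

  data Inclusion : Set where
    _⊑_ : Concept → Concept → Inclusion

  data Assertion : Set where
    instanceOf : Concept → N-I → Assertion
    related    : N-R → N-I → N-I → Assertion
    member     : Concept → Concept → Assertion
    -- roleMember R C D is the axiom (C , D) ∈ R.
    roleMember : N-R → Concept → Concept → Assertion

  record KB : Set where
    field
      tbox : List Inclusion
      abox : List Assertion

  -- The concepts occurring as an instance in a membership axiom of K.
  data Instance (K : KB) : Pred Concept 0ℓ where
    elt : ∀ {C D}   → member C D ∈ˡ KB.abox K       → Instance K C
    fst : ∀ {R C D} → roleMember R C D ∈ˡ KB.abox K → Instance K C
    snd : ∀ {R C D} → roleMember R C D ∈ˡ KB.abox K → Instance K D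


module ALCOI (N-C N-R N-I : Set) where

  infixr 7 _⊓_
  infixr 6 _⊔_
  infix  4 _⊑_
  infix  8 ~_
  infix  9 _⁻

  data Role : Set where
    role : N-R → Role
    _⁻   : N-R → Role

  data Concept : Set where
    name     : N-C → Concept
    ⊤ᶜ ⊥ᶜ    : Concept
    _⊓_ _⊔_  : Concept → Concept → Concept
    ~_       : Concept → Concept
    all some : Role → Concept → Concept
    nominal  : N-I → Concept

  data Inclusion : Set where
    _⊑_ : Concept → Concept → Inclusion

  data Assertion : Set where
    instanceOf : Concept → N-I → Assertion
    related    : N-R → N-I → N-I → Assertion

  -- Sets of axioms rather than lists: the translation below produces one
  -- assertion for every individual name, and there may be infinitely many.
  record KB : Set₁ where
    field
      tbox : Pred Inclusion 0ℓ
      abox : Pred Assertion 0ℓ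

  record Interpretation : Set₁ where
    field
      Δ         : Set
      inhabited : Δ
      conceptᴵ  : N-C → Pred Δ 0ℓ
      roleᴵ     : N-R → Rel Δ 0ℓ
      indᴵ      : N-I → Δ

  module Semantics (I : Interpretation) where
    open Interpretation I

    ⟦_⟧ᴿ : Role → Rel Δ 0ℓ
    ⟦ role R ⟧ᴿ = roleᴵ R
    ⟦ R ⁻ ⟧ᴿ    = flip (roleᴵ R)

    ⟦_⟧ : Concept → Pred Δ 0ℓ
    ⟦ name A ⟧    = conceptᴵ A
    ⟦ ⊤ᶜ ⟧        = U
    ⟦ ⊥ᶜ ⟧        = ∅
    ⟦ C ⊓ D ⟧     = ⟦ C ⟧ ∩ ⟦ D ⟧
    ⟦ C ⊔ D ⟧     = ⟦ C ⟧ ∪ ⟦ D ⟧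
    ⟦ ~ C ⟧       = ∁ ⟦ C ⟧
    ⟦ all R C ⟧   = λ x → ∀ y → ⟦ R ⟧ᴿ x y → y ∈ ⟦ C ⟧
    ⟦ some R C ⟧  = λ x → ∃[ y ] (⟦ R ⟧ᴿ x y × y ∈ ⟦ C ⟧)
    ⟦ nominal a ⟧ = ｛ indᴵ a ｝

    SatisfiesInclusion : Pred Inclusion 0ℓ
    SatisfiesInclusion (C ⊑ D) = ⟦ C ⟧ ⊆ ⟦ D ⟧

    SatisfiesAssertion : Pred Assertion 0ℓ
    SatisfiesAssertion (instanceOf C a) = indᴵ a ∈ ⟦ C ⟧
    SatisfiesAssertion (related R a b)  = roleᴵ R (indᴵ a) (indᴵ b)

  _IsModelOf_ : Interpretation → KB → Set
  I IsModelOf K =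
    KB.tbox K ⊆ SatisfiesInclusion × KB.abox K ⊆ SatisfiesAssertion
    where open Semantics I

  Finite : Interpretation → Set
  Finite I = ∃[ n ] (Interpretation.Δ I ↔ Fin n)

  HasModel : KB → Set₁
  HasModel K = ∃[ I ] (I IsModelOf K)

  HasFiniteModel : KB → Set₁
  HasFiniteModel K = ∃[ I ] (I IsModelOf K × Finite I)


module Translation (N-C N-R N-I : Set) where

  module Ω = ALCΩ N-C N-R N-I

  data RoleName : Set where
    old : N-R → RoleName
    e   : RoleName

  -- e[ C ] is the individual name e_C.  It is available for every C, but
  -- axioms about it arise only for the instances C in membership axioms.
  data IndName : Set where
    old  : N-I → IndName
    e[_] : Ω.Concept → IndName

  open ALCOI N-C RoleName IndName public

  infix 10 _ᵀ

  _ᵀ : Ω.Concept → Concept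
  Ω.name A ᵀ   = name A
  Ω.⊤ᶜ ᵀ       = ⊤ᶜ
  Ω.⊥ᶜ ᵀ       = ⊥ᶜ
  (C Ω.⊓ D) ᵀ  = C ᵀ ⊓ D ᵀ
  (C Ω.⊔ D) ᵀ  = C ᵀ ⊔ D ᵀ
  (Ω.~ C) ᵀ    = ~ (C ᵀ)
  (C Ω.∖ D) ᵀ  = C ᵀ ⊓ ~ (D ᵀ)
  Ω.Pow C ᵀ    = all (role e) (C ᵀ)
  Ω.all R C ᵀ  = all (role (old R)) (C ᵀ)
  Ω.some R C ᵀ = some (role (old R)) (C ᵀ)

  -- An equivalence C ≡ D is the pair of inclusions C ⊑ D and D ⊑ C.
  data TBoxᵀ (K : Ω.KB) : Pred Inclusion 0ℓ where
    inclusion : ∀ {C D} → (C Ω.⊑ D) ∈ˡ Ω.KB.tbox K →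
                TBoxᵀ K (C ᵀ ⊑ D ᵀ)
    ext-⊑     : ∀ {C} → Ω.Instance K C →
                TBoxᵀ K (C ᵀ ⊑ some (e ⁻) (nominal e[ C ]))
    ext-⊒     : ∀ {C} → Ω.Instance K C →
                TBoxᵀ K (some (e ⁻) (nominal e[ C ]) ⊑ C ᵀ)

  data ABoxᵀ (K : Ω.KB) : Pred Assertion 0ℓ where
    member     : ∀ {C D} → Ω.member C D ∈ˡ Ω.KB.abox K →
                 ABoxᵀ K (instanceOf (D ᵀ) e[ C ])
    roleMember : ∀ {R C D} → Ω.roleMember R C D ∈ˡ Ω.KB.abox K →
                 ABoxᵀ K (related (old R) e[ C ] e[ D ])
    inst       : ∀ {D a} → Ω.instanceOf D a ∈ˡ Ω.KB.abox K →
                 ABoxᵀ K (instanceOf (D ᵀ) (old a))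
    rel        : ∀ {R a b} → Ω.related R a b ∈ˡ Ω.KB.abox K →
                 ABoxᵀ K (related (old R) (old a) (old b))
    urelement  : ∀ a → ABoxᵀ K (instanceOf (~ some (role e) ⊤ᶜ) (old a))

  translate : Ω.KB → KB
  translate K = record { tbox = TBoxᵀ K ; abox = ABoxᵀ K }

{-# OPTIONS --safe #-}

-- Filtration.  Identify domain elements that agree on the finitely many
-- subconcepts of the concepts of the knowledge base, and let a role hold
-- between two classes when it holds between some of their members.  This
-- relation commutes with inverses, and a nominal among the subconcepts has a
-- singleton class, so the quotient satisfies the same of these concepts.
-- Although there may be infinitely many individual names, the translation
-- has only finitely many concepts: the urelement assertions all share one.

module Submission where

open import Defs
open import Axiom.ExcludedMiddle using (ExcludedMiddle)
open import Data.Empty using (⊥-elim)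
open import Data.Fin.Base using (Fin; zero; _↑ˡ_; _↑ʳ_; splitAt)
open import Data.Fin.Properties using (splitAt-↑ˡ; splitAt-↑ʳ; splitAt⁻¹-↑ˡ; splitAt⁻¹-↑ʳ)
open import Data.List.Base using (List; []; _∷_; _++_; concatMap)
open import Data.List.Membership.Propositional using (lose) renaming (_∈_ to _∈ˡ_)
open import Data.List.Membership.Propositional.Properties using (∈-++⁺ˡ; ∈-++⁺ʳ; ∈-concatMap⁺)
open import Data.List.Relation.Binary.Subset.Propositional using () renaming (_⊆_ to _⊆ˡ_)
open import Data.List.Relation.Unary.All as All using (All; []; _∷_)
open import Data.List.Relation.Unary.Any using (here; there)
open import Data.Nat.Base using (ℕ; _+_)
open import Data.Product.Base using (_×_; _,_; ∃; ∃-syntax; proj₁; proj₂)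
open import Data.Sum.Base using (inj₁; inj₂; [_,_]′)
import Data.Sum.Base as Sum
open import Function.Base using (_∘_)
open import Function.Bundles using (_⇔_; mk⇔; Equivalence)
open import Function.Construct.Identity using (↔-id; ⇔-id)
open import Function.Construct.Symmetry using (⇔-sym)
open import Level using (0ℓ)
open import Relation.Binary.Core using (Rel)
open import Relation.Binary.PropositionalEquality using (_≡_; refl; sym; trans; cong; subst)
open import Relation.Nullary using (¬_; Dec; yes; no)
open import Relation.Unary using (Pred; _∈_)

open Equivalence using (to; from)

-- Representatives for agreement on finitely many predicates.

module _ {A J : Set} (P : J → Pred A 0ℓ) where

  Agree : List J → Rel A 0ℓ
  Agree js x y = All (λ j → P j x ⇔ P j y) js

  Agree-refl : ∀ js {x} → Agree js x x
  Agree-refl js = All.universal (λ _ → ⇔-id _) js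

  Agree-sym : ∀ {js x y} → Agree js x y → Agree js y x
  Agree-sym = All.map ⇔-sym

-- A transversal in place of a quotient type, so that the quotient is literally some `Fin size`.
-- `rep-inj` lets agreement of representatives yield equality of indices, which nominals require
-- because equality interprets them.
record Representatives {A : Set} (_≈_ : Rel A 0ℓ) : Set where
  field
    size      : ℕ
    rep       : Fin size → A
    class     : A → Fin size
    rep-class : ∀ x → rep (class x) ≈ x
    rep-inj   : ∀ {i j} → rep i ≈ rep j → i ≡ j

module _ (em : ExcludedMiddle 0ℓ) where

  -- Induction on the list: excluded middle splits `A` into the elements with `P j` and those
  -- without, each half is a type of its own with fewer predicates left, and the two transversals
  -- are put side by side.
  representatives : ∀ {A J : Set} (P : J → Pred A 0ℓ) js →
                    Representatives (Agree P js)
  -- With no predicate left all elements agree, so there is one class, or none when this cell of the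
  -- splitting is empty.
  representatives {A} P [] with em {A}
  ... | yes a = record
    { size = 1 ; rep = λ _ → a ; class = λ _ → zero
    ; rep-class = λ _ → []
    ; rep-inj = λ { {zero} {zero} _ → refl } }
  ... | no ¬a = record
    { size = 0 ; rep = λ () ; class = ⊥-elim ∘ ¬a
    ; rep-class = ⊥-elim ∘ ¬a ; rep-inj = λ { {()} } }
  representatives {A} P (j ∷ js) = record
    { size = In.size + Out.size
    ; rep = rep′ ∘ splitAt In.size
    -- The decision is passed as an argument so that `rep-class′` can match on it.
    ; class = λ x → class′ x em
    ; rep-class = λ x → rep-class′ x em
    ; rep-inj = λ {i} {k} → rep-inj′ i k
    }
    where
    module In  = Representatives
      (representatives {∃ (P j)} (λ k → P k ∘ proj₁) js)
    module Out = Representatives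
      (representatives {∃ (¬_ ∘ P j)} (λ k → P k ∘ proj₁) js)

    rep′ = [ proj₁ ∘ In.rep , proj₁ ∘ Out.rep ]′

    class′ : ∀ x → Dec (P j x) → Fin (In.size + Out.size)
    class′ x (yes p) = In.class (x , p) ↑ˡ Out.size
    class′ x (no ¬p) = In.size ↑ʳ Out.class (x , ¬p)

    rep-class′ : ∀ x d → Agree P (j ∷ js) (rep′ (splitAt In.size (class′ x d))) x
    rep-class′ x (yes p)
      rewrite splitAt-↑ˡ In.size (In.class (x , p)) Out.size =
      mk⇔ (λ _ → p) (λ _ → proj₂ (In.rep (In.class (x , p)))) ∷
      In.rep-class (x , p)
    rep-class′ x (no ¬p)
      rewrite splitAt-↑ʳ In.size Out.size (Out.class (x , ¬p)) =
      mk⇔ (⊥-elim ∘ proj₂ (Out.rep (Out.class (x , ¬p)))) (⊥-elim ∘ ¬p) ∷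
      Out.rep-class (x , ¬p)

    rep-inj′ : ∀ i k → Agree P (j ∷ js) (rep′ (splitAt In.size i)) (rep′ (splitAt In.size k)) →
               i ≡ k
    rep-inj′ i k a with splitAt In.size i in eqᵢ | splitAt In.size k in eqₖ | a
    ... | inj₁ u | inj₁ v | _ ∷ as =
      trans (sym (splitAt⁻¹-↑ˡ eqᵢ)) (trans (cong (_↑ˡ Out.size) (In.rep-inj as)) (splitAt⁻¹-↑ˡ eqₖ))
    -- Representatives from different halves disagree on `P j` itself.
    ... | inj₁ u | inj₂ v | h ∷ _ = ⊥-elim (proj₂ (Out.rep v) (to h (proj₂ (In.rep u))))
    ... | inj₂ u | inj₁ v | h ∷ _ = ⊥-elim (proj₂ (Out.rep u) (from h (proj₂ (In.rep v))))
    ... | inj₂ u | inj₂ v | _ ∷ as =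
      trans (sym (splitAt⁻¹-↑ʳ eqᵢ)) (trans (cong (In.size ↑ʳ_) (Out.rep-inj as)) (splitAt⁻¹-↑ʳ eqₖ))

-- Filtration and the truth lemma.

module Filtration (em : ExcludedMiddle 0ℓ) (N-C N-R N-I : Set) where

  open ALCOI N-C N-R N-I

  subconcepts : Concept → List Concept
  subconcepts C = C ∷ proper C
    where
    proper : Concept → List Concept
    proper (C ⊓ D)    = subconcepts C ++ subconcepts D
    proper (C ⊔ D)    = subconcepts C ++ subconcepts D
    proper (~ C)      = subconcepts C
    proper (all R C)  = subconcepts C
    proper (some R C) = subconcepts C
    proper _          = []

  module _ (I : Interpretation) (Σ : List Concept) where

    open Interpretation I
    open Semantics I

    infix 4 _≈_
    _≈_ : Rel Δ 0ℓ
    _≈_ = Agree ⟦_⟧ Σ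

    ≈-refl : ∀ {x} → x ≈ x
    ≈-refl = Agree-refl ⟦_⟧ Σ

    ≈-sym : ∀ {x y} → x ≈ y → y ≈ x
    ≈-sym = Agree-sym ⟦_⟧

    ≈-resp : ∀ {C x y} → C ∈ˡ Σ → x ≈ y → x ∈ ⟦ C ⟧ → y ∈ ⟦ C ⟧
    ≈-resp C∈Σ x≈y = to (All.lookup x≈y C∈Σ)

    open Representatives (representatives em ⟦_⟧ Σ)

    -- The smallest filtration. Both ends of an edge range over whole classes, since an edge leaving
    -- `rep i` may end in an element that represents nothing.
    filtration : Interpretation
    filtration = record
      { Δ         = Fin size
      ; inhabited = class inhabited
      ; conceptᴵ  = λ A i → rep i ∈ conceptᴵ A
      ; roleᴵ     = λ R i j → ∃[ x ] ∃[ y ] (x ≈ rep i × y ≈ rep j × roleᴵ R x y)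
      ; indᴵ      = class ∘ indᴵ
      }

    module F = Semantics filtration

    role⁺ : ∀ R {x y i j} → x ≈ rep i → y ≈ rep j → ⟦ R ⟧ᴿ x y → F.⟦ R ⟧ᴿ i j
    role⁺ (role _) x≈ y≈ r = _ , _ , x≈ , y≈ , r
    role⁺ (_ ⁻)    x≈ y≈ r = _ , _ , y≈ , x≈ , r

    role⁻ : ∀ R {i j} → F.⟦ R ⟧ᴿ i j → ∃[ x ] ∃[ y ] (x ≈ rep i × y ≈ rep j × ⟦ R ⟧ᴿ x y)
    role⁻ (role _) r = r
    role⁻ (_ ⁻) (x , y , x≈ , y≈ , r) = y , x , y≈ , x≈ , r

    role-class : ∀ R {i y} → ⟦ R ⟧ᴿ (rep i) y → F.⟦ R ⟧ᴿ i (class y)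
    role-class R {y = y} = role⁺ R ≈-refl (≈-sym (rep-class y))

    -- Induction on `C`. An edge of the filtration comes from an edge between `x` and `y` that need
    -- not be representatives, so the quantified concept has to be moved between `x` and `rep i`,
    -- and its body between `y` and `rep j`; both lie in `Σ`.
    truth : ∀ C → subconcepts C ⊆ˡ Σ → ∀ {i} → i ∈ F.⟦ C ⟧ ⇔ rep i ∈ ⟦ C ⟧
    truth (name A) Σ⊇ = ⇔-id _
    truth ⊤ᶜ       Σ⊇ = ⇔-id _
    truth ⊥ᶜ       Σ⊇ = ⇔-id _
    truth (C ⊓ D)  Σ⊇ = mk⇔ (λ (c , d) → to ihC c , to ihD d) (λ (c , d) → from ihC c , from ihD d)
      where
      ihC = λ {i} → truth C (Σ⊇ ∘ there ∘ ∈-++⁺ˡ) {i}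
      ihD = λ {i} → truth D (Σ⊇ ∘ there ∘ ∈-++⁺ʳ (subconcepts C)) {i}
    truth (C ⊔ D)  Σ⊇ = mk⇔ (Sum.map (to ihC) (to ihD)) (Sum.map (from ihC) (from ihD))
      where
      ihC = λ {i} → truth C (Σ⊇ ∘ there ∘ ∈-++⁺ˡ) {i}
      ihD = λ {i} → truth D (Σ⊇ ∘ there ∘ ∈-++⁺ʳ (subconcepts C)) {i}
    truth (~ C)    Σ⊇ = mk⇔ (_∘ from ih) (_∘ to ih)
      where ih = λ {i} → truth C (Σ⊇ ∘ there) {i}
    truth (all R C) Σ⊇ = mk⇔
      (λ f y r → ≈-resp (Σ⊇ (there (here refl))) (rep-class y) (to ih (f (class y) (role-class R r))))
      (λ f j r → let (x , y , x≈ , y≈ , r′) = role⁻ R r in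
        from ih (≈-resp (Σ⊇ (there (here refl))) y≈ (≈-resp (Σ⊇ (here refl)) (≈-sym x≈) f y r′)))
      where ih = λ {i} → truth C (Σ⊇ ∘ there) {i}
    truth (some R C) Σ⊇ = mk⇔
      (λ (j , r , c) → let (x , y , x≈ , y≈ , r′) = role⁻ R r in
        ≈-resp (Σ⊇ (here refl)) x≈
          (y , r′ , ≈-resp (Σ⊇ (there (here refl))) (≈-sym y≈) (to ih c)))
      (λ (y , r , c) → class y , role-class R r ,
        from ih (≈-resp (Σ⊇ (there (here refl))) (≈-sym (rep-class y)) c))
      where ih = λ {i} → truth C (Σ⊇ ∘ there) {i}
    truth (nominal a) Σ⊇ = mk⇔
      -- As `nominal a` is in `Σ`, whatever agrees with the element named `a` is that element, in
      -- particular its representative.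
      (λ { refl → ≈-resp (Σ⊇ (here refl)) (≈-sym (rep-class (indᴵ a))) refl })
      (λ eq → rep-inj (subst (rep (class (indᴵ a)) ≈_) eq (rep-class (indᴵ a))))

    truth-class : ∀ {C} → subconcepts C ⊆ˡ Σ → ∀ {x} → x ∈ ⟦ C ⟧ → class x ∈ F.⟦ C ⟧
    truth-class {C} Σ⊇ {x} = from (truth C Σ⊇) ∘ ≈-resp (Σ⊇ (here refl)) (≈-sym (rep-class x))

  -- Finitely many concepts suffice, even with infinitely many axioms. Inclusions are checked at
  -- representatives by the truth lemma; role assertions contribute no concepts, because every edge
  -- of the given model survives between classes.
  finiteModel : ∀ {K} (Cs : List Concept) →
    (∀ {C D} → (C ⊑ D) ∈ KB.tbox K → C ∈ˡ Cs × D ∈ˡ Cs) →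
    (∀ {C a} → instanceOf C a ∈ KB.abox K → C ∈ˡ Cs) →
    HasModel K → HasFiniteModel K
  finiteModel {K} Cs tbox⊆ abox⊆ (I , tboxᴵ , aboxᴵ) =
    filtration I Σ , ((λ {α} → inclusions α) , (λ {α} → assertions α)) , _ , ↔-id _
    where
    Σ = concatMap subconcepts Cs

    open Semantics (filtration I Σ)

    Σ⊇ : ∀ {C} → C ∈ˡ Cs → subconcepts C ⊆ˡ Σ
    Σ⊇ C∈ D∈ = ∈-concatMap⁺ subconcepts (lose C∈ D∈)

    inclusions : ∀ α → α ∈ KB.tbox K → SatisfiesInclusion α
    inclusions (C ⊑ D) α∈ =
      from (truth I Σ D (Σ⊇ (proj₂ (tbox⊆ α∈)))) ∘ tboxᴵ α∈ ∘
      to (truth I Σ C (Σ⊇ (proj₁ (tbox⊆ α∈))))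

    assertions : ∀ α → α ∈ KB.abox K → SatisfiesAssertion α
    assertions (instanceOf C a) α∈ = truth-class I Σ (Σ⊇ (abox⊆ α∈)) (aboxᴵ α∈)
    assertions (related R a b) α∈ =
      role⁺ I Σ (role R) (≈-sym I Σ (rep-class _)) (≈-sym I Σ (rep-class _)) (aboxᴵ α∈)
      where
      open Representatives (representatives em (Semantics.⟦_⟧ I) Σ)

-- The finitely many concepts of the translated knowledge base.

module Concepts (N-C N-R N-I : Set) where

  open Translation N-C N-R N-I

  extension : Ω.Concept → Concept
  extension C = some (e ⁻) (nominal e[ C ])

  inclusionConcepts : Ω.Inclusion → List Concept
  inclusionConcepts (C Ω.⊑ D) = C ᵀ ∷ D ᵀ ∷ []

  -- A membership axiom also accounts for the terminological equivalence of each of its instances,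
  -- hence both `C ᵀ` and `extension C`.
  assertionConcepts : Ω.Assertion → List Concept
  assertionConcepts (Ω.instanceOf C a)   = C ᵀ ∷ []
  assertionConcepts (Ω.related R a b)    = []
  assertionConcepts (Ω.member C D)       = D ᵀ ∷ C ᵀ ∷ extension C ∷ []
  assertionConcepts (Ω.roleMember R C D) = C ᵀ ∷ extension C ∷ D ᵀ ∷ extension D ∷ []

  module _ (K : Ω.KB) where

    concepts : List Concept
    concepts = ~ some (role e) ⊤ᶜ ∷
      concatMap inclusionConcepts (Ω.KB.tbox K) ++ concatMap assertionConcepts (Ω.KB.abox K)

    fromInclusion : ∀ {α C} → α ∈ˡ Ω.KB.tbox K → C ∈ˡ inclusionConcepts α → C ∈ˡ concepts
    fromInclusion α∈ C∈ = there (∈-++⁺ˡ (∈-concatMap⁺ inclusionConcepts (lose α∈ C∈)))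

    fromAssertion : ∀ {α C} → α ∈ˡ Ω.KB.abox K → C ∈ˡ assertionConcepts α → C ∈ˡ concepts
    fromAssertion α∈ C∈ =
      there (∈-++⁺ʳ (concatMap inclusionConcepts (Ω.KB.tbox K))
        (∈-concatMap⁺ assertionConcepts (lose α∈ C∈)))

    instance∈ : ∀ {C} → Ω.Instance K C → C ᵀ ∈ˡ concepts × extension C ∈ˡ concepts
    instance∈ (Ω.elt α∈) =
      fromAssertion α∈ (there (here refl)) , fromAssertion α∈ (there (there (here refl)))
    instance∈ (Ω.fst α∈) =
      fromAssertion α∈ (here refl) , fromAssertion α∈ (there (here refl))
    instance∈ (Ω.snd α∈) =
      fromAssertion α∈ (there (there (here refl))) ,
      fromAssertion α∈ (there (there (there (here refl))))

    tbox∈ : ∀ {C D} → TBoxᵀ K (C ⊑ D) → C ∈ˡ concepts × D ∈ˡ concepts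
    tbox∈ (inclusion α∈) = fromInclusion α∈ (here refl) , fromInclusion α∈ (there (here refl))
    tbox∈ (ext-⊑ C∈)     = instance∈ C∈
    tbox∈ (ext-⊒ C∈)     = let (c , ext) = instance∈ C∈ in ext , c

    abox∈ : ∀ {C a} → ABoxᵀ K (instanceOf C a) → C ∈ˡ concepts
    abox∈ (member α∈)   = fromAssertion α∈ (here refl)
    abox∈ (inst α∈)     = fromAssertion α∈ (here refl)
    abox∈ (urelement a) = here refl

proposition2 : ExcludedMiddle 0ℓ →
    (N-C N-R N-I : Set) (K : ALCΩ.KB N-C N-R N-I) →
    let open Translation N-C N-R N-I in
    HasModel (translate K) → HasFiniteModel (translate K)
proposition2 em N-C N-R N-I K = finiteModel (concepts K) (tbox∈ K) (abox∈ K)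
  where
  open Concepts N-C N-R N-I
  open Translation N-C N-R N-I using (RoleName; IndName)
  open Filtration em N-C RoleName IndName
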